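{- Let $G$ be a graph with edge set $E$, let $C\subseteq E$ and let $k\ge1$ be an integer. Then $C$ is a circuit of $M_k(G)$ if and only if $\Delta G\langle C\rangle=k$ and $G\langle C\rangle$ is a cacti-graph, i.e. $G\langle C\rangle$ has no leaves and every component of $G\langle C\rangle$ has at least two cycles.
   Context: Graphs are finite, may have loops and parallel edges. A leaf is a vertex incident to exactly one edge, which is not a loop. $\Delta H=|E(H)|-|V(H)|$. For $X\subseteq E$, $G\langle X\rangle$ is the subgraph with edge set $X$ and vertex set the vertices incident to edges of $X$. A cacti-graph is a graph with no isolated vertices, no leaves, and no component that is a cycle. For an integer $k\ge0$, the $k$-circular matroid $M_k(G)$ is the matroid on $E$ whose family of circuits ${\cal C}_k(G)$ is the set of inclusion-minimal members of $\{C\subseteq E: C\neq\emptyset,\ |C|=|V(G\langle C\rangle)|+k\}$ (this family is the circuit family of a matroid). -}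

module Defs where

open import Data.Nat using (ℕ; _+_)
open import Data.Integer using (ℤ; +_; _-_)
open import Data.Fin using (Fin)
open import Data.Fin.Properties using (_≟_; any?)
open import Data.Fin.Subset using (Subset; _∈_; _⊆_; ∣_∣; Nonempty)
open import Data.Fin.Subset.Properties using (_∈?_)
open import Data.List using (List; []; _∷_)
open import Data.List.Membership.Propositional using () renaming (_∈_ to _∈ₗ_)
open import Data.List.Relation.Unary.Unique.Propositional using (Unique)
open import Data.Product using (Σ-syntax; ∃-syntax; _×_; _,_; proj₁; proj₂)
open import Data.Sum using (_⊎_)
open import Data.Vec using (tabulate)
open import Data.Vec.Properties using (lookup∘tabulate; lookup⇒[]=)
open import Relation.Binary.PropositionalEquality using (_≡_; _≢_; trans)
open import Relation.Nullary using (¬_; Dec; does)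
open import Relation.Nullary.Decidable using (_×-dec_; _⊎-dec_; dec-true)

-- The two ends of an edge are stored as an ordered pair, but every notion
-- below is insensitive to that order.  Equal ends give a loop, and distinct
-- edges may have the same ends.
record Graph : Set where
  field
    order : ℕ
    size  : ℕ
    ends  : Fin size → Fin order × Fin order

  Vertex : Set
  Vertex = Fin order

  Edge : Set
  Edge = Fin size

  VertexSet : Set
  VertexSet = Subset order

  EdgeSet : Set
  EdgeSet = Subset size

  Joins : Edge → Vertex → Vertex → Set
  Joins e u v = ends e ≡ (u , v) ⊎ ends e ≡ (v , u)

  Incident : Edge → Vertex → Set
  Incident e v = proj₁ (ends e) ≡ v ⊎ proj₂ (ends e) ≡ v

  IsLoop : Edge → Set
  IsLoop e = proj₁ (ends e) ≡ proj₂ (ends e)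

  incident? : ∀ e v → Dec (Incident e v)
  incident? e v = (proj₁ (ends e) ≟ v) ⊎-dec (proj₂ (ends e) ≟ v)

open Graph

record Subgraph (G : Graph) : Set where
  field
    V      : VertexSet G
    E      : EdgeSet G
    closed : ∀ {e v} → e ∈ E → Incident G e v → v ∈ V

open Subgraph public

module _ (G : Graph) where

  covered? : (X : EdgeSet G) (v : Vertex G) →
             Dec (∃[ e ] (e ∈ X × Incident G e v))
  covered? X v = any? λ e → (e ∈? X) ×-dec incident? G e v

  cover : EdgeSet G → VertexSet G
  cover X = tabulate λ v → does (covered? X v)

_⟨_⟩ : (G : Graph) → EdgeSet G → Subgraph G
G ⟨ X ⟩ = record
  { V      = cover G X
  ; E      = X
  ; closed = λ {e} {v} e∈X inc →
      lookup⇒[]= v (cover G X)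
        (trans (lookup∘tabulate (λ u → does (covered? G X u)) v)
               (dec-true (covered? G X v) (e , e∈X , inc)))
  }

module _ {G : Graph} where

  infix 4 _⊑_ _≋_

  Δ : Subgraph G → ℤ
  Δ H = + ∣ E H ∣ - + ∣ V H ∣

  _⊑_ : Subgraph G → Subgraph G → Set
  H ⊑ K = V H ⊆ V K × E H ⊆ E K

  -- Equality of subgraphs, ignoring the proofs in the field `closed`.
  _≋_ : Subgraph G → Subgraph G → Set
  H ≋ K = V H ≡ V K × E H ≡ E K

  IsIsolated : Subgraph G → Vertex G → Set
  IsIsolated H v = v ∈ V H × ¬ (∃[ e ] (e ∈ E H × Incident G e v))

  IsLeaf : Subgraph G → Vertex G → Set
  IsLeaf H v =
    v ∈ V H ×
    ∃[ e ] (e ∈ E H × Incident G e v × ¬ IsLoop G e ×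
            (∀ f → f ∈ E H → Incident G f v → f ≡ e))

  data Walk (H : Subgraph G) : Vertex G → Vertex G → Set where
    nil  : ∀ {u} → Walk H u u
    cons : ∀ {u v w} (e : Edge G) → e ∈ E H → Joins G e u v →
           Walk H v w → Walk H u w

  edges : ∀ {H u v} → Walk H u v → List (Edge G)
  edges nil            = []
  edges (cons e _ _ w) = e ∷ edges w

  -- All vertices visited, in order, except the final one; on a closed walk
  -- this lists the common first and last vertex once.
  starts : ∀ {H u v} → Walk H u v → List (Vertex G)
  starts nil                = []
  starts (cons {u} _ _ _ w) = u ∷ starts w

  IsConnected : Subgraph G → Set
  IsConnected H = Nonempty (V H) × (∀ u v → u ∈ V H → v ∈ V H → Walk H u v)

  IsComponent : Subgraph G → Subgraph G → Set
  IsComponent H K =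
    K ⊑ H × IsConnected K ×
    (∀ L → L ⊑ H → IsConnected L → K ⊑ L → L ⊑ K)

  -- A closed walk v₀ e₁ v₁ … eₗ v₀ (l ≥ 1) with distinct vertices and distinct
  -- edges, using all of H.  A loop (l = 1) and a pair of parallel edges
  -- (l = 2) are cycles; distinctness of the edges excludes, for l = 2, going
  -- back and forth along a single edge.
  IsCycle : Subgraph G → Set
  IsCycle H =
    ∃[ u ] Σ[ w ∈ Walk H u u ]
      (edges w ≢ [] × Unique (starts w) × Unique (edges w) ×
       (∀ v → v ∈ V H → v ∈ₗ starts w) ×
       (∀ e → e ∈ E H → e ∈ₗ edges w))

  NoLeaves : Subgraph G → Set
  NoLeaves H = ∀ v → ¬ IsLeaf H v

  IsCactiGraph : Subgraph G → Set
  IsCactiGraph H =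
    (∀ v → ¬ IsIsolated H v) ×
    NoLeaves H ×
    (∀ K → IsComponent H K → ¬ IsCycle K)

  HasTwoCycles : Subgraph G → Set
  HasTwoCycles K =
    ∃[ Z₁ ] ∃[ Z₂ ]
      (Z₁ ⊑ K × IsCycle Z₁ × Z₂ ⊑ K × IsCycle Z₂ × ¬ (Z₁ ≋ Z₂))

Tight : (k : ℕ) (G : Graph) → EdgeSet G → Set
Tight k G C = Nonempty C × ∣ C ∣ ≡ ∣ V (G ⟨ C ⟩) ∣ + k

-- Membership in 𝒞ₖ(G), the circuit family of the matroid Mₖ(G) on the edge
-- set of G.
IsCircuitM : (k : ℕ) (G : Graph) → EdgeSet G → Set
IsCircuitM k G C = Tight k G C × (∀ D → Tight k G D → D ⊆ C → D ≡ C)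

{-# OPTIONS --safe #-}
module Submission where

-- Consider pairs of W ⊆ V(G⟨C⟩) and F ⊆ C such that F contains every edge of C
-- meeting W ("absorbing" pairs), and call C expanding if |W| < |F| whenever F
-- is nonempty.  For k ≥ 1, the circuits of Mₖ(G) are exactly the expanding sets
-- with ΔG⟨C⟩ = k: if |F| ≤ |W| then Δ does not drop on passing to C ─ F, and a
-- set with Δ ≥ k contains a tight one, while a smaller tight set D ⊂ C gives
-- the pair (V(C) ─ V(D), C ─ D) with |W| = |F|.  On the other hand, C is
-- expanding iff G⟨C⟩ is a cacti-graph: a leaf or a cycle component is a pair
-- with |F| ≤ |W|; conversely, without leaves 2|W| ≤ ∑ deg ≤ 2|F|, so |F| ≤ |W|
-- makes all degrees on W equal to 2 and any cycle in F a component.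

open import Defs
open import Algebra.Bundles using (AbelianGroup)
open import Data.Bool using (Bool; true; false)
open import Data.Fin using (Fin; zero; suc)
open import Data.Fin.Properties using (_≟_; any?)
open import Data.Fin.Subset
  using (Subset; _∈_; _∉_; _⊆_; ∣_∣; Nonempty; ⁅_⁆; _─_; _-_; outside) renaming (⊤ to full)
open import Data.Fin.Subset.Properties
  using (_∈?_; x∈⁅x⁆; x∈⁅y⁆⇒x≡y; ∣⁅x⁆∣≡1; p─q⊆p; x∈p∧x∉q⇒x∈p─q; x∈p∧x≢y⇒x∈p-y;
         x∈p⇒∣p-x∣<∣p∣; p⊆q⇒∣p∣≤∣q∣; ⊆-antisym; ∈⊤)
open import Data.Integer as ℤ using (+_)
import Data.Integer.Properties as ℤₚ
open import Data.List using (List; []; _∷_; map)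
open import Data.List.Membership.Propositional using () renaming (_∈_ to _∈ₗ_; _∉_ to _∉ₗ_)
open import Data.List.Relation.Unary.All using (All; []; _∷_)
open import Data.List.Relation.Unary.All.Properties using (¬Any⇒All¬; All¬⇒¬Any)
open import Data.List.Relation.Unary.Any using (here; there)
open import Data.List.Relation.Unary.AllPairs using ([]; _∷_)
open import Data.List.Relation.Unary.Unique.Propositional using (Unique)
import Data.List.Membership.DecPropositional as DecMembership
open import Data.Nat using (ℕ; zero; suc; _+_; _*_; _≤_; _<_; z≤n; s≤s; s≤s⁻¹)
open import Data.Nat.ListAction using () renaming (sum to sumₗ)
open import Data.Nat.Tactic.RingSolver using (solve-∀)
open import Data.Nat.Properties hiding (_≟_)
open import Data.Product using (Σ-syntax; ∃; ∃-syntax; _×_; _,_; proj₁; proj₂)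
open import Data.Sum using (_⊎_; inj₁; inj₂)
open import Data.Vec using (tabulate; lookup; []; _∷_)
  renaming (here to hereᵥ; there to thereᵥ)
open import Data.Vec.Properties using (lookup∘tabulate; lookup⇒[]=; []=⇒lookup)
open import Function using (_∘_)
open import Function.Bundles using (_⇔_; mk⇔)
open import Relation.Binary.PropositionalEquality
open import Relation.Nullary using (¬_; Dec; yes; no; does; contradiction)
open import Relation.Nullary.Decidable using (_×-dec_; _⊎-dec_; ¬?; dec-true; dec-false)

open import Algebra.Properties.Group (AbelianGroup.group ℤₚ.+-0-abelianGroup)
  using (//-rightDividesˡ; //-rightDividesʳ)
open import Algebra.Properties.CommutativeSemigroup +-commutativeSemigroup using (xy∙z≈xz∙y)
open import Algebra.Properties.CommutativeSemigroup *-commutativeSemigroup using (x∙yz≈y∙xz)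
open import Algebra.Properties.Semiring.Sum +-*-semiring
  using (sum; sum-cong-≗; ∑-distrib-+; ∑-comm; *-distribˡ-sum)

private variable
  n : ℕ

-- Integer differences as equations between natural numbers.

m-n≡k⇒m≡n+k : ∀ {m k} n → + m ℤ.- + n ≡ + k → m ≡ n + k
m-n≡k⇒m≡n+k {m} {k} n m-n≡k = ℤₚ.+-injective (begin
  + m                    ≡⟨ //-rightDividesˡ (+ n) (+ m) ⟨
  (+ m ℤ.- + n) ℤ.+ + n  ≡⟨ cong (ℤ._+ + n) m-n≡k ⟩
  + (k + n)              ≡⟨ cong (λ i → + i) (+-comm k n) ⟩
  + (n + k)              ∎)
  where open ≡-Reasoning

m≡n+k⇒m-n≡k : ∀ {m k} n → m ≡ n + k → + m ℤ.- + n ≡ + k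
m≡n+k⇒m-n≡k {k = k} n refl = begin
  + (n + k) ℤ.- + n      ≡⟨ cong (λ i → + i ℤ.- + n) (+-comm n k) ⟩
  + (k + n) ℤ.- + n      ≡⟨ //-rightDividesʳ (+ n) (+ k) ⟩
  + k                    ∎
  where open ≡-Reasoning

-- Finite sums and subsets

𝟙 : Bool → ℕ
𝟙 true  = 1
𝟙 false = 0

δ : Fin n → Fin n → ℕ
δ x y = 𝟙 (does (x ≟ y))

δ-refl : (x : Fin n) → δ x x ≡ 1
δ-refl x = cong 𝟙 (dec-true (x ≟ x) refl)

δ-≢ : {x y : Fin n} → x ≢ y → δ x y ≡ 0
δ-≢ {x = x} {y} x≢y = cong 𝟙 (dec-false (x ≟ y) x≢y)

χ : Subset n → Fin n → ℕ
χ p i = 𝟙 (lookup p i)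

χ-∈ : {p : Subset n} {i : Fin n} → i ∈ p → χ p i ≡ 1
χ-∈ i∈p = cong 𝟙 ([]=⇒lookup i∈p)

χ-∉ : {p : Subset n} {i : Fin n} → i ∉ p → χ p i ≡ 0
χ-∉ {p = p} {i} i∉p with lookup p i in eq
... | true  = contradiction (lookup⇒[]= i p eq) i∉p
... | false = refl

χ≤1 : (p : Subset n) (i : Fin n) → χ p i ≤ 1
χ≤1 p i with lookup p i
... | true  = s≤s z≤n
... | false = z≤n

∣p∣≡∑χ : (p : Subset n) → ∣ p ∣ ≡ sum (χ p)
∣p∣≡∑χ []          = refl
∣p∣≡∑χ (true  ∷ p) = cong suc (∣p∣≡∑χ p)
∣p∣≡∑χ (false ∷ p) = ∣p∣≡∑χ p

sum-mono-≤ : {f g : Fin n → ℕ} → (∀ i → f i ≤ g i) → sum f ≤ sum g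
sum-mono-≤ {n = zero}  f≤g = z≤n
sum-mono-≤ {n = suc n} f≤g = +-mono-≤ (f≤g zero) (sum-mono-≤ (f≤g ∘ suc))

-- A strict inequality at one index could not be made up for at the others. This extracts the
-- equality case of a counting argument.
sum-tight : {f g : Fin n → ℕ} → (∀ i → f i ≤ g i) → sum g ≤ sum f → ∀ i → g i ≤ f i
sum-tight {n = suc n} {f} {g} f≤g ∑g≤∑f zero =
  +-cancelʳ-≤ (sum (f ∘ suc)) (g zero) (f zero)
    (≤-trans (+-monoʳ-≤ (g zero) (sum-mono-≤ (f≤g ∘ suc))) ∑g≤∑f)
sum-tight {n = suc n} {f} {g} f≤g ∑g≤∑f (suc i) =
  sum-tight (f≤g ∘ suc)
    (+-cancelˡ-≤ (f zero) _ _ (≤-trans (+-monoˡ-≤ _ (f≤g zero)) ∑g≤∑f)) i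

term≤sum : (f : Fin n → ℕ) (i : Fin n) → f i ≤ sum f
term≤sum f zero    = m≤m+n _ _
term≤sum f (suc i) = ≤-trans (term≤sum (f ∘ suc) i) (m≤n+m _ _)

two-terms≤sum : (f : Fin n → ℕ) {i j : Fin n} → i ≢ j → f i + f j ≤ sum f
two-terms≤sum f {zero}  {zero}  i≢j = contradiction refl i≢j
two-terms≤sum f {zero}  {suc j} i≢j = +-monoʳ-≤ (f zero) (term≤sum (f ∘ suc) j)
two-terms≤sum f {suc i} {zero}  i≢j =
  ≤-trans (≤-reflexive (+-comm (f (suc i)) (f zero)))
          (+-monoʳ-≤ (f zero) (term≤sum (f ∘ suc) i))
two-terms≤sum f {suc i} {suc j} i≢j =
  ≤-trans (two-terms≤sum (f ∘ suc) (i≢j ∘ cong suc)) (m≤n+m _ _)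

sum-zero : {f : Fin n → ℕ} → (∀ i → f i ≡ 0) → sum f ≡ 0
sum-zero {n = zero}  f≡0 = refl
sum-zero {n = suc n} f≡0 = cong₂ _+_ (f≡0 zero) (sum-zero (f≡0 ∘ suc))

∑-δ : (f : Fin n → ℕ) (x : Fin n) → sum (λ v → f v * δ x v) ≡ f x
∑-δ f zero = begin
  f zero * 1 + sum (λ v → f (suc v) * 0)
    ≡⟨ cong₂ _+_ (*-identityʳ _) (sum-zero (λ v → *-zeroʳ (f (suc v)))) ⟩
  f zero + 0 ≡⟨ +-identityʳ _ ⟩
  f zero ∎
  where open ≡-Reasoning
∑-δ f (suc x) = begin
  f zero * 0 + sum (λ v → f (suc v) * δ (suc x) (suc v))
    ≡⟨ cong (_+ sum (λ v → f (suc v) * δ x v)) (*-zeroʳ (f zero)) ⟩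
  sum (λ v → f (suc v) * δ x v) ≡⟨ ∑-δ (f ∘ suc) x ⟩
  f (suc x) ∎
  where open ≡-Reasoning

∑-*2 : (p : Subset n) → sum (λ i → χ p i * 2) ≡ 2 * ∣ p ∣
∑-*2 p = begin
  sum (λ i → χ p i * 2) ≡⟨ sum-cong-≗ (λ i → *-comm (χ p i) 2) ⟩
  sum (λ i → 2 * χ p i) ≡⟨ *-distribˡ-sum 2 (χ p) ⟨
  2 * sum (χ p)         ≡⟨ cong (2 *_) (∣p∣≡∑χ p) ⟨
  2 * ∣ p ∣             ∎
  where open ≡-Reasoning

disjoint⇒∣p∣+∣q∣≤∣r∣ : {p q r : Subset n} → p ⊆ r → q ⊆ r → (∀ {x} → x ∈ p → x ∉ q) →
                       ∣ p ∣ + ∣ q ∣ ≤ ∣ r ∣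
disjoint⇒∣p∣+∣q∣≤∣r∣ {p = p} {q} {r} p⊆r q⊆r disj = begin
  ∣ p ∣ + ∣ q ∣             ≡⟨ cong₂ _+_ (∣p∣≡∑χ p) (∣p∣≡∑χ q) ⟩
  sum (χ p) + sum (χ q)     ≡⟨ ∑-distrib-+ (χ p) (χ q) ⟨
  sum (λ i → χ p i + χ q i) ≤⟨ sum-mono-≤ pointwise ⟩
  sum (χ r)                 ≡⟨ ∣p∣≡∑χ r ⟨
  ∣ r ∣                     ∎
  where
  open ≤-Reasoning
  pointwise : ∀ i → χ p i + χ q i ≤ χ r i
  pointwise i with i ∈? p | i ∈? q
  ... | yes i∈p | _       = ≤-reflexive (trans (cong₂ _+_ (χ-∈ i∈p) (χ-∉ (disj i∈p))) (sym (χ-∈ (p⊆r i∈p))))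
  ... | no  i∉p | yes i∈q = ≤-reflexive (trans (cong₂ _+_ (χ-∉ i∉p) (χ-∈ i∈q)) (sym (χ-∈ (q⊆r i∈q))))
  ... | no  i∉p | no  i∉q = ≤-trans (≤-reflexive (cong₂ _+_ (χ-∉ i∉p) (χ-∉ i∉q))) z≤n

split⇒∣r∣≤∣p∣+∣q∣ : {p q r : Subset n} → (∀ {x} → x ∈ r → x ∈ p ⊎ x ∈ q) → ∣ r ∣ ≤ ∣ p ∣ + ∣ q ∣
split⇒∣r∣≤∣p∣+∣q∣ {p = p} {q} {r} split = begin
  ∣ r ∣                     ≡⟨ ∣p∣≡∑χ r ⟩
  sum (χ r)                 ≤⟨ sum-mono-≤ pointwise ⟩
  sum (λ i → χ p i + χ q i) ≡⟨ ∑-distrib-+ (χ p) (χ q) ⟩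
  sum (χ p) + sum (χ q)     ≡⟨ cong₂ _+_ (∣p∣≡∑χ p) (∣p∣≡∑χ q) ⟨
  ∣ p ∣ + ∣ q ∣             ∎
  where
  open ≤-Reasoning
  pointwise : ∀ i → χ r i ≤ χ p i + χ q i
  pointwise i with i ∈? r
  ... | no i∉r = ≤-trans (≤-reflexive (χ-∉ i∉r)) z≤n
  ... | yes i∈r with split i∈r
  ...   | inj₁ i∈p = ≤-trans (≤-trans (χ≤1 r i) (≤-reflexive (sym (χ-∈ i∈p)))) (m≤m+n _ _)
  ...   | inj₂ i∈q = ≤-trans (≤-trans (χ≤1 r i) (≤-reflexive (sym (χ-∈ i∈q)))) (m≤n+m _ _)

x∈p─q⇒x∉q : (p q : Subset n) {x : Fin n} → x ∈ p ─ q → x ∉ q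
x∈p─q⇒x∉q (_ ∷ p) (outside ∷ q) hereᵥ         ()
x∈p─q⇒x∉q (_ ∷ p) (_ ∷ q)       (thereᵥ x∈p─q) (thereᵥ x∈q) = x∈p─q⇒x∉q p q x∈p─q x∈q

x∉p-x : (p : Subset n) (x : Fin n) → x ∉ p - x
x∉p-x p x x∈p-x = x∈p─q⇒x∉q p ⁅ x ⁆ x∈p-x (x∈⁅x⁆ x)

∣p─q∣+∣q∣≡∣p∣ : (p q : Subset n) → q ⊆ p → ∣ p ─ q ∣ + ∣ q ∣ ≡ ∣ p ∣
∣p─q∣+∣q∣≡∣p∣ p q q⊆p = ≤-antisym
  (disjoint⇒∣p∣+∣q∣≤∣r∣ (p─q⊆p p q) q⊆p (x∈p─q⇒x∉q p q))
  (split⇒∣r∣≤∣p∣+∣q∣ {p = p ─ q} {q} {p} split)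
  where
  split : ∀ {x} → x ∈ p → x ∈ p ─ q ⊎ x ∈ q
  split {x} x∈p with x ∈? q
  ... | yes x∈q = inj₂ x∈q
  ... | no  x∉q = inj₁ (x∈p∧x∉q⇒x∈p─q x∈p x∉q)

⁅x⁆⊆p : {p : Subset n} {x : Fin n} → x ∈ p → ⁅ x ⁆ ⊆ p
⁅x⁆⊆p {p = p} {x} x∈p y∈⁅x⁆ = subst (_∈ p) (sym (x∈⁅y⁆⇒x≡y x y∈⁅x⁆)) x∈p

1+∣p-x∣≡∣p∣ : (p : Subset n) {x : Fin n} → x ∈ p → suc ∣ p - x ∣ ≡ ∣ p ∣
1+∣p-x∣≡∣p∣ p {x} x∈p = begin
  suc ∣ p - x ∣           ≡⟨ +-comm 1 _ ⟩
  ∣ p - x ∣ + 1           ≡⟨ cong (_+_ ∣ p - x ∣) (∣⁅x⁆∣≡1 x) ⟨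
  ∣ p - x ∣ + ∣ ⁅ x ⁆ ∣   ≡⟨ ∣p─q∣+∣q∣≡∣p∣ p ⁅ x ⁆ (⁅x⁆⊆p x∈p) ⟩
  ∣ p ∣                   ∎
  where open ≡-Reasoning

x∈p⇒1≤∣p∣ : {p : Subset n} {x : Fin n} → x ∈ p → 1 ≤ ∣ p ∣
x∈p⇒1≤∣p∣ {p = p} x∈p = ≤-trans (s≤s z≤n) (≤-reflexive (1+∣p-x∣≡∣p∣ p x∈p))

1≤∣p∣⇒Nonempty : (p : Subset n) → 1 ≤ ∣ p ∣ → Nonempty p
1≤∣p∣⇒Nonempty (true  ∷ p) _ = zero , hereᵥ
1≤∣p∣⇒Nonempty (false ∷ p) 1≤ with 1≤∣p∣⇒Nonempty p 1≤
... | x , x∈p = suc x , thereᵥ x∈p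

module _ {P : Fin n → Set} (P? : ∀ i → Dec (P i)) where

  -- `cover G X` unfolds to the instance at `covered? G X`, so the two rules below serve for covers
  -- as well.
  comprehension : Subset n
  comprehension = tabulate (does ∘ P?)

  comprehension⁺ : ∀ {i} → P i → i ∈ comprehension
  comprehension⁺ {i} p = lookup⇒[]= i _ (trans (lookup∘tabulate (does ∘ P?) i) (dec-true (P? i) p))

  comprehension⁻ : ∀ {i} → i ∈ comprehension → P i
  comprehension⁻ {i} i∈ with P? i in eq
  ... | yes p = p
  ... | no ¬p with trans (sym ([]=⇒lookup i∈)) (trans (lookup∘tabulate (does ∘ P?) i) (cong does eq))
  ...   | ()

-- Multiplicities in lists.

mult : Fin n → List (Fin n) → ℕ
mult i l = sumₗ (map (λ j → δ j i) l)

mult-∉ : {i : Fin n} (l : List (Fin n)) → i ∉ₗ l → mult i l ≡ 0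
mult-∉ []      _   = refl
mult-∉ (j ∷ l) i∉l = cong₂ _+_ (δ-≢ {x = j} (i∉l ∘ here ∘ sym)) (mult-∉ l (i∉l ∘ there))

mult-∈ : {i : Fin n} {l : List (Fin n)} → Unique l → i ∈ₗ l → mult i l ≡ 1
mult-∈ {i = i} {_ ∷ l} (i∉l ∷ _) (here refl) =
  cong₂ _+_ (δ-refl i) (mult-∉ l (All¬⇒¬Any i∉l))
mult-∈ {l = j ∷ _} (j∉l ∷ u) (there i∈l) =
  cong₂ _+_ (δ-≢ {x = j} (λ { refl → All¬⇒¬Any j∉l i∈l })) (mult-∈ u i∈l)

-- An exchange of summation. For a duplicate-free list `mult` is an indicator function, so a degree
-- in a cycle becomes a sum along its walk.
sum-mult : (f : Fin n → ℕ) (l : List (Fin n)) → sum (λ i → mult i l * f i) ≡ sumₗ (map f l)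
sum-mult f []      = sum-zero {f = λ i → 0 * f i} (λ _ → refl)
sum-mult f (j ∷ l) = begin
  sum (λ i → (δ j i + mult i l) * f i)
    ≡⟨ sum-cong-≗ (λ i → trans (*-distribʳ-+ (f i) (δ j i) (mult i l))
                               (cong (_+ mult i l * f i) (*-comm (δ j i) (f i)))) ⟩
  sum (λ i → f i * δ j i + mult i l * f i)
    ≡⟨ ∑-distrib-+ (λ i → f i * δ j i) (λ i → mult i l * f i) ⟩
  sum (λ i → f i * δ j i) + sum (λ i → mult i l * f i)
    ≡⟨ cong₂ _+_ (∑-δ f j) (sum-mult f l) ⟩
  f j + sumₗ (map f l) ∎
  where open ≡-Reasoning

module _ {G : Graph} where

  open Graph G using (Vertex; Edge; EdgeSet; VertexSet; Joins; Incident; IsLoop; order; size; ends; incident?)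

  private
    module Vₗ = DecMembership (_≟_ {order})
    module Eₗ = DecMembership (_≟_ {size})

  private variable
    H K Z : Subgraph G
    X : EdgeSet
    u v x : Vertex

  -- Walks

  joins-sym : ∀ {e} → Joins e u v → Joins e v u
  joins-sym (inj₁ eq) = inj₂ eq
  joins-sym (inj₂ eq) = inj₁ eq

  joins⇒incidentˡ : ∀ {e} → Joins e u v → Incident e u
  joins⇒incidentˡ (inj₁ eq) = inj₁ (cong proj₁ eq)
  joins⇒incidentˡ (inj₂ eq) = inj₂ (cong proj₂ eq)

  joins⇒incidentʳ : ∀ {e} → Joins e u v → Incident e v
  joins⇒incidentʳ = joins⇒incidentˡ ∘ joins-sym

  incident⇒end : ∀ {e} → Joins e u v → Incident e x → x ≡ u ⊎ x ≡ v
  incident⇒end (inj₁ eq) (inj₁ p) = inj₁ (trans (sym p) (cong proj₁ eq))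
  incident⇒end (inj₁ eq) (inj₂ p) = inj₂ (trans (sym p) (cong proj₂ eq))
  incident⇒end (inj₂ eq) (inj₁ p) = inj₂ (trans (sym p) (cong proj₁ eq))
  incident⇒end (inj₂ eq) (inj₂ p) = inj₁ (trans (sym p) (cong proj₂ eq))

  other-end : ∀ {e} → Incident e u → ∃[ v ] Joins e v u
  other-end {e = e} (inj₁ refl) = proj₂ (ends e) , inj₂ refl
  other-end {e = e} (inj₂ refl) = proj₁ (ends e) , inj₁ refl

  joins⇒¬loop : ∀ {e} → Joins e u v → u ≢ v → ¬ IsLoop e
  joins⇒¬loop (inj₁ refl) u≢v = u≢v
  joins⇒¬loop (inj₂ refl) u≢v = u≢v ∘ sym

  joins⇒loop : ∀ {e} → Joins e u u → IsLoop e
  joins⇒loop (inj₁ eq) = trans (cong proj₁ eq) (sym (cong proj₂ eq))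
  joins⇒loop (inj₂ eq) = trans (cong proj₁ eq) (sym (cong proj₂ eq))

  cover⁺ : ∀ {e} → e ∈ X → Incident e v → v ∈ cover G X
  cover⁺ {X} e∈X inc = comprehension⁺ (covered? G X) (_ , e∈X , inc)

  cover⁻ : v ∈ cover G X → ∃[ e ] (e ∈ X × Incident e v)
  cover⁻ {X = X} = comprehension⁻ (covered? G X)

  cover⊆V : (K : Subgraph G) → X ⊆ E K → cover G X ⊆ V K
  cover⊆V K X⊆EK v∈ with cover⁻ v∈
  ... | _ , e∈X , inc = closed K (X⊆EK e∈X) inc

  cover-mono : {X Y : EdgeSet} → X ⊆ Y → cover G X ⊆ cover G Y
  cover-mono {Y = Y} = cover⊆V (G ⟨ Y ⟩)

  _++ʷ_ : Walk H u v → Walk H v x → Walk H u x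
  nil          ++ʷ w′ = w′
  cons e i j w ++ʷ w′ = cons e i j (w ++ʷ w′)

  reverseʷ : Walk H u v → Walk H v u
  reverseʷ nil            = nil
  reverseʷ (cons e i j w) = reverseʷ w ++ʷ cons e i (joins-sym j) nil

  mapʷ : E H ⊆ E K → Walk H u v → Walk K u v
  mapʷ H⊆K nil            = nil
  mapʷ H⊆K (cons e i j w) = cons e (H⊆K i) j (mapʷ H⊆K w)

  rooted⇒connected : (H : Subgraph G) → u ∈ V H → (∀ x → x ∈ V H → Walk H u x) → IsConnected H
  rooted⇒connected H u∈H reach =
    (_ , u∈H) , λ x y x∈H y∈H → reverseʷ (reach x x∈H) ++ʷ reach y y∈H

  -- Unlike `starts`, this includes the final vertex, so `Unique (visited w)` says that `w` is a
  -- simple path.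
  visited : Walk H u v → List Vertex
  visited {u = u} nil            = u ∷ []
  visited {u = u} (cons _ _ _ w) = u ∷ visited w

  start-visited : (w : Walk H u v) → u ∈ₗ visited w
  start-visited nil            = here refl
  start-visited (cons _ _ _ _) = here refl

  edges⊆E : ∀ {e} (w : Walk H u v) → e ∈ₗ edges w → e ∈ E H
  edges⊆E (cons _ i _ _) (here refl) = i
  edges⊆E (cons _ _ _ w) (there e∈w) = edges⊆E w e∈w

  starts⊆visited : (w : Walk H u v) → x ∈ₗ starts w → x ∈ₗ visited w
  starts⊆visited (cons _ _ _ _) (here refl) = here refl
  starts⊆visited (cons _ _ _ w) (there x∈w) = there (starts⊆visited w x∈w)

  visited⇒start∨end : (w : Walk H u v) → x ∈ₗ visited w → x ∈ₗ starts w ⊎ x ≡ v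
  visited⇒start∨end nil            (here refl) = inj₂ refl
  visited⇒start∨end (cons _ _ _ w) (here refl) = inj₁ (here refl)
  visited⇒start∨end (cons _ _ _ w) (there x∈w) with visited⇒start∨end w x∈w
  ... | inj₁ x∈s = inj₁ (there x∈s)
  ... | inj₂ x≡v = inj₂ x≡v

  edge-ends-visited : ∀ {e} (w : Walk H u v) → e ∈ₗ edges w → Incident e x → x ∈ₗ visited w
  edge-ends-visited (cons e i j w) (here refl) inc with incident⇒end j inc
  ... | inj₁ refl = here refl
  ... | inj₂ refl = there (start-visited w)
  edge-ends-visited (cons e i j w) (there e∈w) inc = there (edge-ends-visited w e∈w inc)

  closed-visited⊆starts : (w : Walk H u u) → edges w ≢ [] → x ∈ₗ visited w → x ∈ₗ starts w
  closed-visited⊆starts nil                ≢[] _  = contradiction refl ≢[]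
  closed-visited⊆starts w@(cons _ _ _ _)   _   x∈ with visited⇒start∨end w x∈
  ... | inj₁ x∈s  = x∈s
  ... | inj₂ refl = here refl

  starts⊆V : (w : Walk H u v) → x ∈ₗ starts w → x ∈ V H
  starts⊆V {H} (cons _ i j _) (here refl) = closed H i (joins⇒incidentˡ j)
  starts⊆V     (cons _ _ _ w) (there x∈w) = starts⊆V w x∈w

  fresh-edge : ∀ {e} (w : Walk H u v) → Incident e x → x ∉ₗ visited w → e ∉ₗ edges w
  fresh-edge w inc x∉w e∈w = x∉w (edge-ends-visited w e∈w inc)

  -- An initial segment of `w` that is to be closed up into a cycle based at `x`. This is why
  -- `unique-starts` has `x` at the head of the list.
  record Prefix (w : Walk H u v) (x : Vertex) : Set where
    field
      walk           : Walk H u x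
      starts⊆        : ∀ {y} → y ∈ₗ starts walk → y ∈ₗ visited w
      edges⊆         : ∀ {e} → e ∈ₗ edges walk → e ∈ₗ edges w
      unique-starts  : Unique (visited w) → Unique (x ∷ starts walk)
      unique-edges   : Unique (visited w) → Unique (edges walk)

  open Prefix

  prefix : (w : Walk H u v) → x ∈ₗ visited w → Prefix w x
  prefix nil (here refl) = record
    { walk = nil ; starts⊆ = λ () ; edges⊆ = λ ()
    ; unique-starts = λ _ → [] ∷ [] ; unique-edges = λ _ → [] }
  prefix (cons e i j w) (here refl) = record
    { walk = nil ; starts⊆ = λ () ; edges⊆ = λ ()
    ; unique-starts = λ _ → [] ∷ [] ; unique-edges = λ _ → [] }
  prefix {u = u} {x = x} w₀@(cons e i j w) (there x∈w) = record
    { walk    = cons e i j (walk p)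
    ; starts⊆ = λ { (here refl) → here refl ; (there y∈) → there (starts⊆ p y∈) }
    ; edges⊆  = λ { (here refl) → here refl ; (there f∈) → there (edges⊆ p f∈) }
    ; unique-starts = unique-starts′
    ; unique-edges  = λ { (u∉w ∷ uw) →
        ¬Any⇒All¬ _ (fresh-edge w (joins⇒incidentˡ j) (All¬⇒¬Any u∉w) ∘ edges⊆ p)
        ∷ unique-edges p uw }
    }
    where
    p = prefix w x∈w
    unique-starts′ : Unique (visited w₀) → Unique (x ∷ u ∷ starts (walk p))
    unique-starts′ (u∉w ∷ uw) with unique-starts p uw
    ... | x∉p ∷ up =
      ((λ { refl → All¬⇒¬Any u∉w x∈w }) ∷ x∉p)
      ∷ ¬Any⇒All¬ _ (All¬⇒¬Any u∉w ∘ starts⊆ p) ∷ up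

  -- Existence of cycles

  HasCycle : EdgeSet → Set
  HasCycle X = Σ[ Z ∈ Subgraph G ] (IsCycle Z × Z ⊑ G ⟨ X ⟩)

  module _ {X : EdgeSet} where

    restrict : (w : Walk (G ⟨ X ⟩) u v) → (∀ {e} → e ∈ₗ edges w → e ∈ E Z) →
               Σ[ w′ ∈ Walk Z u v ] (starts w′ ≡ starts w × edges w′ ≡ edges w)
    restrict nil            _  = nil , refl , refl
    restrict (cons e i j w) ⊆Z with restrict w (⊆Z ∘ there)
    ... | w′ , p , q = cons e (⊆Z (here refl)) j w′ , cong (_ ∷_) p , cong (e ∷_) q

    -- `IsCycle` requires the walk to exhaust its subgraph, so the walk is moved to the subgraph
    -- spanned by its own edges. Every vertex covered there is visited, and on a closed walk the
    -- last vertex is already among the `starts`.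
    closed-walk⇒cycle : (w : Walk (G ⟨ X ⟩) u u) → edges w ≢ [] →
                        Unique (starts w) → Unique (edges w) → HasCycle X
    closed-walk⇒cycle {u} w ≢[] us ue
      with restrict {Z = G ⟨ comprehension (Eₗ._∈? edges w) ⟩} w (comprehension⁺ (Eₗ._∈? edges w))
    ... | w′ , ps , pe =
      G ⟨ F ⟩ ,
      (u , w′ , subst (_≢ []) (sym pe) ≢[] , subst Unique (sym ps) us , subst Unique (sym pe) ue ,
       (λ x x∈ → subst (x ∈ₗ_) (sym ps) (cover⊆starts x∈)) ,
       (λ e e∈ → subst (e ∈ₗ_) (sym pe) (comprehension⁻ (Eₗ._∈? edges w) e∈))) ,
      cover-mono F⊆X , F⊆X
      where
      F : EdgeSet
      F = comprehension (Eₗ._∈? edges w)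
      F⊆X : F ⊆ X
      F⊆X = edges⊆E w ∘ comprehension⁻ (Eₗ._∈? edges w)
      cover⊆starts : ∀ {x} → x ∈ cover G F → x ∈ₗ starts w
      cover⊆starts x∈ with cover⁻ x∈
      ... | e , e∈F , inc = closed-visited⊆starts w ≢[]
              (edge-ends-visited w (comprehension⁻ (Eₗ._∈? edges w) e∈F) inc)

    loop⇒cycle : ∀ {e} → e ∈ X → Joins e u u → HasCycle X
    loop⇒cycle e∈X j = closed-walk⇒cycle (cons _ e∈X j nil) (λ ()) ([] ∷ []) ([] ∷ [])

    -- A path u v … is extended at u by an edge f ≠ e; the path is simple, so
    -- f either reaches a vertex of the set R of unvisited vertices or closes
    -- a cycle.
    extend-path : ∀ b (R : VertexSet) → ∣ R ∣ ≤ b →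
                  ∀ {u v z e} → e ∈ X → Joins e u v → (w : Walk (G ⟨ X ⟩) v z) →
                  Unique (u ∷ visited w) → (∀ {y} → y ∉ₗ u ∷ visited w → y ∈ R) →
                  ∃ (IsLeaf (G ⟨ X ⟩)) ⊎ HasCycle X
    extend-path b R ∣R∣≤b {u} {v} {e = e} e∈X j w (u∉w ∷ uw) unvisited
      with any? (λ f → (f ∈? X) ×-dec (incident? f u ×-dec ¬? (f ≟ e)))
    ... | no none = inj₁ (u , cover⁺ e∈X (joins⇒incidentˡ j) , e , e∈X , joins⇒incidentˡ j ,
                          joins⇒¬loop j (λ { refl → All¬⇒¬Any u∉w (start-visited w) }) , only-e)
      where
      only-e : ∀ f → f ∈ X → Incident f u → f ≡ e
      only-e f f∈X inc with f ≟ e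
      ... | yes f≡e = f≡e
      ... | no  f≢e = contradiction (f , f∈X , inc , f≢e) none
    ... | yes (f , f∈X , inc , f≢e) with other-end inc
    ...   | x , jf with x ≟ u
    ...     | yes refl = inj₂ (loop⇒cycle f∈X jf)
    ...     | no x≢u with x Vₗ.∈? visited w
    extend-path b R ∣R∣≤b {u} {v} {e = e} e∈X j w (u∉w ∷ uw) unvisited
          | yes (f , f∈X , inc , f≢e) | x , jf | no x≢u | yes x∈w
            with prefix w x∈w
    ...     | p with unique-starts p uw
    ...       | x∉p ∷ up = inj₂ (closed-walk⇒cycle
                -- The cycle runs from `x` along `f` to `u`, along `e` to `v`, and along the prefix
                -- back to `x`. Neither `f` nor `e` recurs in the prefix, since both meet `u`, which
                -- `w` does not visit.
                (cons f f∈X jf (cons e e∈X j (walk p))) (λ ())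
                ((x≢u ∷ x∉p) ∷ ¬Any⇒All¬ _ (All¬⇒¬Any u∉w ∘ starts⊆ p) ∷ up)
                ((f≢e ∷ fresh inc) ∷ fresh (joins⇒incidentˡ j) ∷ unique-edges p uw))
      where
      fresh : ∀ {g} → Incident g u → All (g ≢_) (edges (walk p))
      fresh inc-u = ¬Any⇒All¬ _ (fresh-edge w inc-u (All¬⇒¬Any u∉w) ∘ edges⊆ p)
    extend-path zero R ∣R∣≤b e∈X j w uw unvisited
          | yes _ | x , jf | no x≢u | no x∉w =
      contradiction (≤-trans (x∈p⇒1≤∣p∣ (unvisited λ { (here x≡u) → x≢u x≡u ; (there x∈w) → x∉w x∈w })) ∣R∣≤b) λ ()
    extend-path (suc b) R ∣R∣≤b {u} {e = e} e∈X j w uw unvisited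
          | yes (f , f∈X , _) | x , jf | no x≢u | no x∉w =
      extend-path b (R - x) (s≤s⁻¹ (≤-trans (x∈p⇒∣p-x∣<∣p∣ (unvisited x∉)) ∣R∣≤b))
        f∈X jf (cons e e∈X j w) (¬Any⇒All¬ _ x∉ ∷ uw)
        (λ y∉ → x∈p∧x≢y⇒x∈p-y (unvisited (y∉ ∘ there)) (y∉ ∘ here))
      where
      x∉ : x ∉ₗ u ∷ visited w
      x∉ (here x≡u)  = x≢u x≡u
      x∉ (there x∈w) = x∉w x∈w

    leaf∨cycle : Nonempty X → ∃ (IsLeaf (G ⟨ X ⟩)) ⊎ HasCycle X
    leaf∨cycle (e , e∈X) with proj₁ (ends e) ≟ proj₂ (ends e)
    ... | yes loop = inj₂ (loop⇒cycle e∈X (inj₁ (cong (proj₁ (ends e) ,_) (sym loop))))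
    ... | no ¬loop = extend-path ∣ full {order} ∣ full ≤-refl e∈X (inj₁ refl) nil
                       ((¬loop ∷ []) ∷ [] ∷ []) (λ _ → ∈⊤)

  HasCycle-mono : {X Y : EdgeSet} → X ⊆ Y → HasCycle X → HasCycle Y
  HasCycle-mono X⊆Y (Z , cyc , VZ⊆ , EZ⊆) = Z , cyc , cover-mono X⊆Y ∘ VZ⊆ , X⊆Y ∘ EZ⊆

  -- Deleting a leaf edge costs one edge and at least one covered vertex, so the inequality
  -- survives. The edge set shrinks but never becomes empty, hence at some stage there is no leaf to
  -- delete and `leaf∨cycle` yields a cycle.
  ∣cover∣≤⇒cycle : ∀ m (X : EdgeSet) → ∣ X ∣ ≡ m → Nonempty X → ∣ cover G X ∣ ≤ ∣ X ∣ → HasCycle X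
  ∣cover∣≤⇒cycle m X ∣X∣≡m ne c≤ with leaf∨cycle ne
  ... | inj₂ cyc = cyc
  ∣cover∣≤⇒cycle zero X ∣X∣≡m (e , e∈X) c≤ | inj₁ _ =
    contradiction (≤-trans (x∈p⇒1≤∣p∣ e∈X) (≤-reflexive ∣X∣≡m)) λ ()
  ∣cover∣≤⇒cycle (suc m) X ∣X∣≡m ne c≤ | inj₁ (v , v∈ , e , e∈X , inc , ¬loop , only-e) =
    HasCycle-mono (p─q⊆p X ⁅ e ⁆)
      (∣cover∣≤⇒cycle m (X - e) (suc-injective (trans (1+∣p-x∣≡∣p∣ X e∈X) ∣X∣≡m))
        (1≤∣p∣⇒Nonempty (X - e) (≤-trans (x∈p⇒1≤∣p∣ x∈) rest≤))
        (≤-trans (p⊆q⇒∣p∣≤∣q∣ cover⊆) rest≤))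
    where
    rest≤ : ∣ cover G X - v ∣ ≤ ∣ X - e ∣
    rest≤ = s≤s⁻¹ (≤-trans (≤-reflexive (1+∣p-x∣≡∣p∣ (cover G X) v∈))
              (≤-trans c≤ (≤-reflexive (sym (1+∣p-x∣≡∣p∣ X e∈X)))))
    cover⊆ : cover G (X - e) ⊆ cover G X - v
    cover⊆ y∈ with cover⁻ y∈
    ... | f , f∈X-e , inc-y = x∈p∧x≢y⇒x∈p-y (cover⁺ f∈X inc-y) λ { refl →
          x∉p-x X e (subst (_∈ X - e) (only-e f f∈X inc-y) f∈X-e) }
      where f∈X = p─q⊆p X ⁅ e ⁆ f∈X-e
    -- The other end of e guarantees that X - e is nonempty.
    far : ∃[ x ] Joins e x v
    far = other-end inc
    x∈ : proj₁ far ∈ cover G X - v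
    x∈ = x∈p∧x≢y⇒x∈p-y (cover⁺ e∈X (joins⇒incidentˡ (proj₂ far)))
           λ x≡v → ¬loop (joins⇒loop (subst (λ y → Joins e y v) x≡v (proj₂ far)))

  -- Degrees

  -- A loop counts twice at its vertex, so every edge contributes 2 to the sum of all degrees.
  ends-at : Edge → Vertex → ℕ
  ends-at e v = δ (proj₁ (ends e)) v + δ (proj₂ (ends e)) v

  degree : EdgeSet → Vertex → ℕ
  degree X v = sum (λ e → χ X e * ends-at e v)

  joins⇒ends-at : ∀ {e} → Joins e u v → ends-at e x ≡ δ u x + δ v x
  joins⇒ends-at         (inj₁ refl) = refl
  joins⇒ends-at {u} {v} (inj₂ refl) = +-comm (δ v _) (δ u _)

  1≤ends-at : ∀ {e} → Incident e v → 1 ≤ ends-at e v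
  1≤ends-at {v} (inj₁ refl) = ≤-trans (≤-reflexive (sym (δ-refl v))) (m≤m+n _ _)
  1≤ends-at {v} (inj₂ refl) = ≤-trans (≤-reflexive (sym (δ-refl v))) (m≤n+m _ _)

  -- Double counting of the edge ends that lie in `W`: the order of summation is exchanged, and each
  -- edge then counts how many of its ends are in `W`.
  handshake : (W : VertexSet) (X : EdgeSet) →
              sum (λ v → χ W v * degree X v) ≡
              sum (λ e → χ X e * (χ W (proj₁ (ends e)) + χ W (proj₂ (ends e))))
  handshake W X = begin
    sum (λ v → χ W v * degree X v)
      ≡⟨ sum-cong-≗ (λ v → *-distribˡ-sum (χ W v) (λ e → χ X e * ends-at e v)) ⟩
    sum (λ v → sum (λ e → χ W v * (χ X e * ends-at e v)))
      ≡⟨ ∑-comm (λ v e → χ W v * (χ X e * ends-at e v)) ⟩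
    sum (λ e → sum (λ v → χ W v * (χ X e * ends-at e v)))
      ≡⟨ sum-cong-≗ (λ e → trans
           (sum-cong-≗ (λ v → x∙yz≈y∙xz (χ W v) (χ X e) (ends-at e v)))
           (sym (*-distribˡ-sum (χ X e) (λ v → χ W v * ends-at e v)))) ⟩
    sum (λ e → χ X e * sum (λ v → χ W v * ends-at e v))
      ≡⟨ sum-cong-≗ (λ e → cong (χ X e *_) (∑-ends e)) ⟩
    sum (λ e → χ X e * (χ W (proj₁ (ends e)) + χ W (proj₂ (ends e)))) ∎
    where
    open ≡-Reasoning
    ∑-ends : ∀ e → sum (λ v → χ W v * ends-at e v) ≡ χ W (proj₁ (ends e)) + χ W (proj₂ (ends e))
    ∑-ends e = begin
      sum (λ v → χ W v * (δ a v + δ b v))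
        ≡⟨ sum-cong-≗ (λ v → *-distribˡ-+ (χ W v) (δ a v) (δ b v)) ⟩
      sum (λ v → χ W v * δ a v + χ W v * δ b v)
        ≡⟨ ∑-distrib-+ (λ v → χ W v * δ a v) (λ v → χ W v * δ b v) ⟩
      sum (λ v → χ W v * δ a v) + sum (λ v → χ W v * δ b v)
        ≡⟨ cong₂ _+_ (∑-δ (χ W) a) (∑-δ (χ W) b) ⟩
      χ W a + χ W b ∎
      where
      a = proj₁ (ends e)
      b = proj₂ (ends e)

  -- Each step has one end at its start and one at the next vertex. The list of next vertices is
  -- `starts w` with `u` dropped and `v` added, which accounts for the two outer `δ` terms; on a
  -- closed walk they cancel.
  walk-degree : (w : Walk H u v) (x : Vertex) →
                δ u x + sumₗ (map (λ e → ends-at e x) (edges w)) ≡ 2 * mult x (starts w) + δ v x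
  walk-degree nil x = +-identityʳ _
  walk-degree {u = u} {v} (cons {v = u′} e _ j w) x = begin
    δ u x + (ends-at e x + d)         ≡⟨ cong (λ m → δ u x + (m + d)) (joins⇒ends-at j) ⟩
    δ u x + (δ u x + δ u′ x + d)      ≡⟨ cong (_+_ (δ u x)) (+-assoc (δ u x) (δ u′ x) d) ⟩
    δ u x + (δ u x + (δ u′ x + d))    ≡⟨ cong (λ m → δ u x + (δ u x + m)) (walk-degree w x) ⟩
    δ u x + (δ u x + (2 * m + δ v x)) ≡⟨ rearrange (δ u x) m (δ v x) ⟩
    2 * (δ u x + m) + δ v x           ∎
    where
    open ≡-Reasoning
    d = sumₗ (map (λ e → ends-at e x) (edges w))
    m = mult x (starts w)
    rearrange : ∀ a b c → a + (a + (2 * b + c)) ≡ 2 * (a + b) + c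
    rearrange = solve-∀

  -- The walk lists each edge of `Z` exactly once, so the degree is a sum along the walk. By
  -- `walk-degree` it is twice the number of visits to `x`, and `x` is visited once.
  cycle-degree : (Z : Subgraph G) → IsCycle Z → x ∈ V Z → degree (E Z) x ≡ 2
  cycle-degree {x} Z (u , w , ≢[] , us , ue , V⊆ , E⊆) x∈Z = begin
    sum (λ e → χ (E Z) e * ends-at e x)
      ≡⟨ sum-cong-≗ (λ e → cong (_* ends-at e x) (χ≡mult e)) ⟩
    sum (λ e → mult e (edges w) * ends-at e x)
      ≡⟨ sum-mult (λ e → ends-at e x) (edges w) ⟩
    sumₗ (map (λ e → ends-at e x) (edges w))
      ≡⟨ +-cancelˡ-≡ (δ u x) _ _ (trans (walk-degree w x) (+-comm _ (δ u x))) ⟩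
    2 * mult x (starts w)
      ≡⟨ cong (2 *_) (mult-∈ us (V⊆ x x∈Z)) ⟩
    2 ∎
    where
    open ≡-Reasoning
    χ≡mult : ∀ e → χ (E Z) e ≡ mult e (edges w)
    χ≡mult e with e ∈? E Z
    ... | yes e∈Z = trans (χ-∈ e∈Z) (sym (mult-∈ ue (E⊆ e e∈Z)))
    ... | no  e∉Z = trans (χ-∉ e∉Z) (sym (mult-∉ (edges w) (e∉Z ∘ edges⊆E w)))

  -- The doubled sides are the two counts in `handshake`: all degrees are 2, and each edge has both
  -- ends in `V Z`.
  cycle-balanced : (Z : Subgraph G) → IsCycle Z → ∣ V Z ∣ ≡ ∣ E Z ∣
  cycle-balanced Z cyc = *-cancelˡ-≡ _ _ 2 (begin
    2 * ∣ V Z ∣                               ≡⟨ ∑-*2 (V Z) ⟨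
    sum (λ v → χ (V Z) v * 2)                 ≡⟨ sum-cong-≗ at-vertex ⟩
    sum (λ v → χ (V Z) v * degree (E Z) v)    ≡⟨ handshake (V Z) (E Z) ⟩
    sum (λ e → χ (E Z) e * (χ (V Z) (proj₁ (ends e)) + χ (V Z) (proj₂ (ends e))))
                                              ≡⟨ sum-cong-≗ at-edge ⟩
    sum (λ e → χ (E Z) e * 2)                 ≡⟨ ∑-*2 (E Z) ⟩
    2 * ∣ E Z ∣                               ∎)
    where
    open ≡-Reasoning
    at-vertex : ∀ v → χ (V Z) v * 2 ≡ χ (V Z) v * degree (E Z) v
    at-vertex v with v ∈? V Z
    ... | yes v∈Z = cong (χ (V Z) v *_) (sym (cycle-degree Z cyc v∈Z))
    ... | no  v∉Z rewrite χ-∉ v∉Z = refl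
    at-edge : ∀ e → χ (E Z) e * (χ (V Z) (proj₁ (ends e)) + χ (V Z) (proj₂ (ends e))) ≡ χ (E Z) e * 2
    at-edge e with e ∈? E Z
    ... | yes e∈Z = cong (χ (E Z) e *_)
                      (cong₂ _+_ (χ-∈ (closed Z e∈Z (inj₁ refl))) (χ-∈ (closed Z e∈Z (inj₂ refl))))
    ... | no  e∉Z rewrite χ-∉ e∉Z = refl

  -- A loop at `v` already contributes 2. Otherwise an edge at `v` has a companion there, or else
  -- `v` would be a leaf.
  noLeaves⇒2≤degree : NoLeaves (G ⟨ X ⟩) → v ∈ cover G X → 2 ≤ degree X v
  noLeaves⇒2≤degree {X} {v} ¬leaf v∈ with cover⁻ {X = X} v∈
  ... | e , e∈X , inc with proj₁ (ends e) ≟ proj₂ (ends e)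
  ...   | yes loop = begin
    2                    ≡⟨ trans (joins⇒ends-at (joins-self inc)) (cong₂ _+_ (δ-refl v) (δ-refl v)) ⟨
    ends-at e v          ≡⟨ *-identityˡ _ ⟨
    1 * ends-at e v      ≡⟨ cong (_* ends-at e v) (χ-∈ e∈X) ⟨
    χ X e * ends-at e v  ≤⟨ term≤sum (λ e → χ X e * ends-at e v) e ⟩
    degree X v           ∎
    where
    open ≤-Reasoning
    joins-self : Incident e v → Joins e v v
    joins-self (inj₁ refl) = inj₁ (cong (proj₁ (ends e) ,_) (sym loop))
    joins-self (inj₂ refl) = inj₁ (cong (_, proj₂ (ends e)) loop)
  ...   | no ¬loop with any? (λ f → (f ∈? X) ×-dec (incident? f v ×-dec ¬? (f ≟ e)))
  ...     | yes (f , f∈X , inc-f , f≢e) =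
    ≤-trans (+-mono-≤ (1≤term f∈X inc-f) (1≤term e∈X inc))
            (two-terms≤sum (λ e → χ X e * ends-at e v) f≢e)
    where
    1≤term : ∀ {e} → e ∈ X → Incident e v → 1 ≤ χ X e * ends-at e v
    1≤term e∈X inc = *-mono-≤ (≤-reflexive (sym (χ-∈ e∈X))) (1≤ends-at inc)
  ...     | no none = contradiction (v∈ , e , e∈X , inc , ¬loop , only-e) (¬leaf v)
    where
    only-e : ∀ f → f ∈ X → Incident f v → f ≡ e
    only-e f f∈X inc-f with f ≟ e
    ... | yes f≡e = f≡e
    ... | no  f≢e = contradiction (f , f∈X , inc-f , f≢e) none

  -- Components

  -- A local substitute for maximality. For a connected subgraph of `G ⟨ C ⟩` it is equivalent to
  -- being a component, as the lemmas below show.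
  Saturated : EdgeSet → Subgraph G → Set
  Saturated C Z = ∀ {e v} → e ∈ C → v ∈ V Z → Incident e v → e ∈ E Z

  -- A walk in `K` that starts in `Z` can never leave `Z`, and every vertex of `K` is reached by
  -- such a walk from `u`.
  saturated-connected : (K Z : Subgraph G) → IsConnected K → Saturated (E K) Z →
                        u ∈ V Z → u ∈ V K → K ⊑ Z
  saturated-connected {u} K Z (_ , conn) sat u∈Z u∈K = V⊆ , E⊆
    where
    propagate : ∀ {x y} → Walk K x y → x ∈ V Z → y ∈ V Z
    propagate nil            x∈Z = x∈Z
    propagate (cons e i j w) x∈Z =
      propagate w (closed Z (sat i x∈Z (joins⇒incidentˡ j)) (joins⇒incidentʳ j))
    V⊆ : V K ⊆ V Z
    V⊆ x∈K = propagate (conn u _ u∈K x∈K) u∈Z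
    E⊆ : E K ⊆ E Z
    E⊆ e∈K = sat e∈K (V⊆ (closed K e∈K (inj₁ refl))) (inj₁ refl)

  cycle-connected : (Z : Subgraph G) → IsCycle Z → IsConnected Z
  cycle-connected Z (u , nil , ≢[] , _) = contradiction refl ≢[]
  cycle-connected Z (u , w@(cons _ _ _ _) , _ , _ , _ , V⊆ , _) =
    rooted⇒connected Z (starts⊆V w (here refl))
      (λ x x∈Z → walk (prefix w (starts⊆visited w (V⊆ x x∈Z))))

  -- Degrees inside a cycle are 2, so degree 2 in X leaves no room for further edges of X.
  cycle-saturated : (Z : Subgraph G) → IsCycle Z → E Z ⊆ X →
                    (∀ {v} → v ∈ V Z → degree X v ≤ 2) → Saturated X Z
  cycle-saturated {X} Z cyc Z⊆X deg≤2 {e} {v} e∈X v∈Z inc with e ∈? E Z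
  ... | yes e∈Z = e∈Z
  ... | no  e∉Z = contradiction (begin
    1                         ≤⟨ 1≤ends-at inc ⟩
    ends-at e v               ≡⟨ *-identityˡ _ ⟨
    1 * ends-at e v           ≡⟨ cong (_* ends-at e v) (χ-∈ e∈X) ⟨
    χ X e * ends-at e v       ≤⟨ sum-tight fewer
                                   (≤-trans (deg≤2 v∈Z) (≤-reflexive (sym (cycle-degree Z cyc v∈Z)))) e ⟩
    χ (E Z) e * ends-at e v   ≡⟨ cong (_* ends-at e v) (χ-∉ e∉Z) ⟩
    0                         ∎) λ ()
    where
    open ≤-Reasoning
    fewer : ∀ f → χ (E Z) f * ends-at f v ≤ χ X f * ends-at f v
    fewer f with f ∈? E Z
    ... | yes f∈Z = ≤-reflexive (cong (_* ends-at f v) (trans (χ-∈ f∈Z) (sym (χ-∈ (Z⊆X f∈Z)))))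
    ... | no  f∉Z rewrite χ-∉ f∉Z = z≤n

  -- All degrees in `K` are 2 and `Z` uses them up, so `Z` is saturated in the connected graph `K`.
  subcycle-of-cycle : (K Z : Subgraph G) → IsCycle K → IsCycle Z → Z ⊑ K → Z ≋ K
  subcycle-of-cycle K Z cycK cycZ (VZ⊆ , EZ⊆) = ⊆-antisym VZ⊆ (proj₁ K⊑Z) , ⊆-antisym EZ⊆ (proj₂ K⊑Z)
    where
    nonempty : Nonempty (V Z)
    nonempty = proj₁ (cycle-connected Z cycZ)
    K⊑Z : K ⊑ Z
    K⊑Z = saturated-connected K Z (cycle-connected K cycK)
            (cycle-saturated Z cycZ EZ⊆ (λ v∈Z → ≤-reflexive (cycle-degree K cycK (VZ⊆ v∈Z))))
            (proj₂ nonempty) (VZ⊆ (proj₂ nonempty))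

  saturated-connected⇒component : (Z H : Subgraph G) → Z ⊑ H → IsConnected Z → Saturated (E H) Z →
                                  IsComponent H Z
  saturated-connected⇒component Z H Z⊑H conn@((u , u∈Z) , _) sat =
    Z⊑H , conn , λ L L⊑H connL Z⊑L →
      saturated-connected L Z connL (sat ∘ proj₂ L⊑H) u∈Z (proj₁ Z⊑L u∈Z)

  -- Adjoining `e` and its ends to `K` gives a connected subgraph `L` of `H`. By maximality `L` lies
  -- in `K`, and so does `e`.
  component-saturated : (H K : Subgraph G) → IsComponent H K → Saturated (E H) K
  component-saturated H K ((VK⊆ , EK⊆) , (_ , conn) , maximal) {e} {v} e∈H v∈K inc =
    proj₂ (maximal L (VL⊆ , EL⊆) connL (V⁺ ∘ inj₁ , E⁺ ∘ inj₁)) (E⁺ (inj₂ refl))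
    where
    inV? : ∀ x → Dec (x ∈ V K ⊎ Incident e x)
    inV? x = (x ∈? V K) ⊎-dec incident? e x
    inE? : ∀ f → Dec (f ∈ E K ⊎ f ≡ e)
    inE? f = (f ∈? E K) ⊎-dec (f ≟ e)
    V⁺ : ∀ {x} → x ∈ V K ⊎ Incident e x → x ∈ comprehension inV?
    V⁺ = comprehension⁺ inV?
    E⁺ : ∀ {f} → f ∈ E K ⊎ f ≡ e → f ∈ comprehension inE?
    E⁺ = comprehension⁺ inE?
    L : Subgraph G
    L = record { V = comprehension inV? ; E = comprehension inE? ; closed = closed′ }
      where
      closed′ : ∀ {f x} → f ∈ comprehension inE? → Incident f x → x ∈ comprehension inV?
      closed′ f∈ inc′ with comprehension⁻ inE? f∈
      ... | inj₁ f∈K  = V⁺ (inj₁ (closed K f∈K inc′))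
      ... | inj₂ refl = V⁺ (inj₂ inc′)
    VL⊆ : V L ⊆ V H
    VL⊆ x∈ with comprehension⁻ inV? x∈
    ... | inj₁ x∈K  = VK⊆ x∈K
    ... | inj₂ inc′ = closed H e∈H inc′
    EL⊆ : E L ⊆ E H
    EL⊆ f∈ with comprehension⁻ inE? f∈
    ... | inj₁ f∈K  = EK⊆ f∈K
    ... | inj₂ refl = e∈H
    reach : ∀ x → x ∈ V L → Walk L v x
    reach x x∈ with comprehension⁻ inV? x∈
    ... | inj₁ x∈K  = mapʷ (E⁺ ∘ inj₁) (conn v x v∈K x∈K)
    ... | inj₂ inc′ with other-end inc
    ...   | y , j with incident⇒end j inc′
    ...     | inj₁ refl = cons e (E⁺ (inj₂ refl)) (joins-sym j) nil
    ...     | inj₂ refl = nil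
    connL : IsConnected L
    connL = rooted⇒connected L (V⁺ (inj₁ v∈K)) reach

  -- Absorbing pairs

  -- The pair need not be a subgraph: edges of `F` may have ends outside `W`.
  record Absorbs (C : EdgeSet) (W : VertexSet) (F : EdgeSet) : Set where
    field
      edges-in    : F ⊆ C
      vertices-in : W ⊆ cover G C
      absorbs     : ∀ {e v} → e ∈ C → v ∈ W → Incident e v → e ∈ F

  open Absorbs

  Expanding : EdgeSet → Set
  Expanding C = ∀ {W F} → Absorbs C W F → Nonempty F → ∣ W ∣ < ∣ F ∣

  component-absorbed : (C : EdgeSet) (K : Subgraph G) → IsComponent (G ⟨ C ⟩) K → Absorbs C (V K) (E K)
  component-absorbed C K comp@((VK⊆ , EK⊆) , _) = record
    { edges-in = EK⊆ ; vertices-in = VK⊆ ; absorbs = component-saturated (G ⟨ C ⟩) K comp }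

  -- Supplies the nonemptiness that `Expanding` asks for: a vertex of `K` is covered by some edge of
  -- `C`, which saturation places in `K`.
  component-has-edge : (C : EdgeSet) (K : Subgraph G) → IsComponent (G ⟨ C ⟩) K → Nonempty (E K)
  component-has-edge C K comp@((VK⊆ , _) , ((v , v∈K) , _) , _) with cover⁻ {X = C} (VK⊆ v∈K)
  ... | e , e∈C , inc = e , component-saturated (G ⟨ C ⟩) K comp e∈C v∈K inc

  -- 2∣W∣ ≤ ∑ deg ≤ 2∣F∣, where the sum runs over W, so all inequalities are equalities if ∣F∣ ≤ ∣W∣.
  noLeaves-absorbs-tight : {C : EdgeSet} {W : VertexSet} {F : EdgeSet} →
    NoLeaves (G ⟨ C ⟩) → Absorbs C W F → ∣ F ∣ ≤ ∣ W ∣ →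
    ∣ W ∣ ≤ ∣ F ∣ × (∀ {v} → v ∈ W → degree C v ≤ 2) × cover G F ⊆ W
  noLeaves-absorbs-tight {C} {W} {F} ¬leaf abs ∣F∣≤∣W∣ =
    *-cancelˡ-≤ 2 2W≤2F , degree≤2 , cover⊆W
    where
    open ≤-Reasoning
    at-vertex : ∀ v → χ W v * 2 ≤ χ W v * degree C v
    at-vertex v with v ∈? W
    ... | yes v∈W = *-monoʳ-≤ (χ W v) (noLeaves⇒2≤degree ¬leaf (vertices-in abs v∈W))
    ... | no  v∉W rewrite χ-∉ v∉W = z≤n

    ends-in : Edge → ℕ
    ends-in e = χ W (proj₁ (ends e)) + χ W (proj₂ (ends e))

    at-edge : ∀ e → χ C e * ends-in e ≤ χ F e * 2
    at-edge e with e ∈? F | e ∈? C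
    ... | yes e∈F | _ = *-mono-≤ (≤-trans (χ≤1 C e) (≤-reflexive (sym (χ-∈ e∈F))))
                                 (+-mono-≤ (χ≤1 W _) (χ≤1 W _))
    ... | no  e∉F | no e∉C rewrite χ-∉ e∉C = z≤n
    -- By absorption, an edge of `C` outside `F` has neither end in `W`.
    ... | no  e∉F | yes e∈C = ≤-trans (≤-reflexive (trans (cong (χ C e *_)
      (cong₂ _+_ (χ-∉ λ in₁ → e∉F (absorbs abs e∈C in₁ (inj₁ refl)))
                 (χ-∉ λ in₂ → e∉F (absorbs abs e∈C in₂ (inj₂ refl))))) (*-zeroʳ (χ C e)))) z≤n

    2W≤deg : 2 * ∣ W ∣ ≤ sum (λ v → χ W v * degree C v)
    2W≤deg = ≤-trans (≤-reflexive (sym (∑-*2 W))) (sum-mono-≤ at-vertex)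

    deg≤2F : sum (λ v → χ W v * degree C v) ≤ 2 * ∣ F ∣
    deg≤2F = begin
      sum (λ v → χ W v * degree C v)  ≡⟨ handshake W C ⟩
      sum (λ e → χ C e * ends-in e)   ≤⟨ sum-mono-≤ at-edge ⟩
      sum (λ e → χ F e * 2)           ≡⟨ ∑-*2 F ⟩
      2 * ∣ F ∣                       ∎

    2W≤2F : 2 * ∣ W ∣ ≤ 2 * ∣ F ∣
    2W≤2F = ≤-trans 2W≤deg deg≤2F

    2F≤2W : 2 * ∣ F ∣ ≤ 2 * ∣ W ∣
    2F≤2W = *-monoʳ-≤ 2 ∣F∣≤∣W∣

    -- `2F≤2W` closes the chain of inequalities, so `at-vertex` is an equality at every vertex.
    degree≤2 : ∀ {v} → v ∈ W → degree C v ≤ 2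
    degree≤2 {v} v∈W = begin
      degree C v          ≡⟨ *-identityˡ _ ⟨
      1 * degree C v      ≡⟨ cong (_* degree C v) (χ-∈ v∈W) ⟨
      χ W v * degree C v  ≤⟨ sum-tight at-vertex
                               (≤-trans deg≤2F (≤-trans 2F≤2W (≤-reflexive (sym (∑-*2 W))))) v ⟩
      χ W v * 2           ≡⟨ cong (_* 2) (χ-∈ v∈W) ⟩
      2                   ∎

    -- Likewise `at-edge` is an equality, so each edge of `F` has both ends in `W`.
    2≤ends-in : ∀ {e} → e ∈ F → 2 ≤ ends-in e
    2≤ends-in {e} e∈F = begin
      2                  ≡⟨ cong (_* 2) (χ-∈ e∈F) ⟨
      χ F e * 2          ≤⟨ sum-tight at-edge (begin
        sum (λ e → χ F e * 2)           ≡⟨ ∑-*2 F ⟩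
        2 * ∣ F ∣                       ≤⟨ ≤-trans 2F≤2W 2W≤deg ⟩
        sum (λ v → χ W v * degree C v)  ≡⟨ handshake W C ⟩
        sum (λ e → χ C e * ends-in e)   ∎) e ⟩
      χ C e * ends-in e  ≡⟨ cong (_* ends-in e) (χ-∈ (edges-in abs e∈F)) ⟩
      1 * ends-in e      ≡⟨ *-identityˡ _ ⟩
      ends-in e          ∎

    cover⊆W : cover G F ⊆ W
    cover⊆W {v} v∈ with v ∈? W | cover⁻ {X = F} v∈
    ... | yes v∈W | _ = v∈W
    ... | no  v∉W | e , e∈F , inj₁ refl =
      contradiction (≤-trans (2≤ends-in e∈F) (+-mono-≤ (≤-reflexive (χ-∉ v∉W)) (χ≤1 W _))) λ { (s≤s ()) }
    ... | no  v∉W | e , e∈F , inj₂ refl =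
      contradiction (≤-trans (2≤ends-in e∈F) (+-mono-≤ (χ≤1 W _) (≤-reflexive (χ-∉ v∉W)))) λ { (s≤s ()) }

  cacti⇒expanding : {C : EdgeSet} → IsCactiGraph (G ⟨ C ⟩) → Expanding C
  cacti⇒expanding {C} (_ , ¬leaf , ¬cycle) {W} {F} abs ne = ≰⇒> λ ∣F∣≤∣W∣ →
    let ∣W∣≤∣F∣ , degree≤2 , cover⊆W = noLeaves-absorbs-tight ¬leaf abs ∣F∣≤∣W∣
        -- The sizes satisfy |cover F| ≤ |W| ≤ |F|, so `F` contains a cycle. Its vertices lie in `W`
        -- and have no spare degree in `C`, which makes it a component.
        Z , cyc , VZ⊆ , EZ⊆ = ∣cover∣≤⇒cycle ∣ F ∣ F refl ne (≤-trans (p⊆q⇒∣p∣≤∣q∣ cover⊆W) ∣W∣≤∣F∣)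
        EZ⊆C : E Z ⊆ C
        EZ⊆C = edges-in abs ∘ EZ⊆
    in ¬cycle Z
         (saturated-connected⇒component Z (G ⟨ C ⟩) (vertices-in abs ∘ cover⊆W ∘ VZ⊆ , EZ⊆C)
           (cycle-connected Z cyc) (cycle-saturated Z cyc EZ⊆C (degree≤2 ∘ cover⊆W ∘ VZ⊆)))
         cyc

  -- Each forbidden structure is an absorbing pair of equal sizes: a leaf with its edge, or the
  -- vertices and edges of a cycle component.
  expanding⇒cacti : {C : EdgeSet} → Expanding C → IsCactiGraph (G ⟨ C ⟩)
  expanding⇒cacti {C} expanding = ¬isolated , ¬leaf , ¬cycle
    where
    ¬isolated : ∀ v → ¬ IsIsolated (G ⟨ C ⟩) v
    ¬isolated v (v∈ , none) = none (cover⁻ v∈)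
    ¬leaf : NoLeaves (G ⟨ C ⟩)
    ¬leaf v (v∈ , e , e∈C , inc , _ , only-e) =
      <-irrefl (trans (∣⁅x⁆∣≡1 v) (sym (∣⁅x⁆∣≡1 e))) (expanding absorbed (e , x∈⁅x⁆ e))
      where
      absorbed : Absorbs C ⁅ v ⁆ ⁅ e ⁆
      absorbed = record
        { edges-in    = ⁅x⁆⊆p e∈C
        ; vertices-in = ⁅x⁆⊆p v∈
        ; absorbs     = λ {f} f∈C x∈ inc′ → subst (_∈ ⁅ e ⁆)
            (sym (only-e f f∈C (subst (Incident f) (x∈⁅y⁆⇒x≡y v x∈) inc′))) (x∈⁅x⁆ e)
        }
    ¬cycle : ∀ K → IsComponent (G ⟨ C ⟩) K → ¬ IsCycle K
    ¬cycle K comp cyc = <-irrefl (cycle-balanced K cyc)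
      (expanding (component-absorbed C K comp) (component-has-edge C K comp))

  -- Circuits of Mₖ(G)

  -- Deleting an edge lowers ∣D∣ - ∣cover D∣ by at most one, so the value k is attained.
  contains-tight : ∀ {k} → 1 ≤ k → ∀ m (D : EdgeSet) → ∣ D ∣ ≡ m → ∣ cover G D ∣ + k ≤ ∣ D ∣ →
                   ∃[ T ] (Tight k G T × T ⊆ D)
  -- As `k` is positive, the inequality itself makes `D` nonempty, as `Tight` requires.
  contains-tight {k} 1≤k m D ∣D∣≡m c+k≤ with 1≤∣p∣⇒Nonempty D (≤-trans 1≤k (≤-trans (m≤n+m _ _) c+k≤))
  ... | ne@(e , e∈D) with m≤n⇒m<n∨m≡n c+k≤
  ...   | inj₂ c+k≡ = D , (ne , sym c+k≡) , λ x∈D → x∈D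
  contains-tight {k} 1≤k zero D ∣D∣≡m c+k≤ | e , e∈D | inj₁ c+k< =
    contradiction (≤-trans (x∈p⇒1≤∣p∣ e∈D) (≤-reflexive ∣D∣≡m)) λ ()
  contains-tight {k} 1≤k (suc m) D ∣D∣≡m c+k≤ | e , e∈D | inj₁ c+k< =
    let T , tight , T⊆D-e = contains-tight 1≤k m (D - e)
          (suc-injective (trans (1+∣p-x∣≡∣p∣ D e∈D) ∣D∣≡m))
          (≤-trans (+-monoˡ-≤ k (p⊆q⇒∣p∣≤∣q∣ (cover-mono D-e⊆D)))
                   (s≤s⁻¹ (≤-trans c+k< (≤-reflexive (sym (1+∣p-x∣≡∣p∣ D e∈D))))))
    in T , tight , D-e⊆D ∘ T⊆D-e
    where
    D-e⊆D : D - e ⊆ D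
    D-e⊆D = p─q⊆p D ⁅ e ⁆

  -- Deleting `F` uncovers all of `W`. If |F| ≤ |W|, then `C ─ F` is still dense enough to contain a
  -- tight set, which by minimality equals `C`, although it misses `e`.
  circuit⇒expanding : ∀ {k} {C : EdgeSet} → 1 ≤ k → IsCircuitM k G C → Expanding C
  circuit⇒expanding {k} {C} 1≤k ((_ , ∣C∣≡) , minimal) {W} {F} abs (e , e∈F) = ≰⇒> λ ∣F∣≤∣W∣ →
    let T , tight , T⊆D = contains-tight 1≤k ∣ C ─ F ∣ (C ─ F) refl (dense ∣F∣≤∣W∣)
        T≡C = minimal T tight (D⊆C ∘ T⊆D)
    in x∈p─q⇒x∉q C F (T⊆D (subst (e ∈_) (sym T≡C) (edges-in abs e∈F))) e∈F
    where
    open ≤-Reasoning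
    D⊆C : C ─ F ⊆ C
    D⊆C = p─q⊆p C F
    disjoint : ∀ {v} → v ∈ cover G (C ─ F) → v ∉ W
    disjoint v∈ v∈W with cover⁻ {X = C ─ F} v∈
    ... | f , f∈D , inc = x∈p─q⇒x∉q C F f∈D (absorbs abs (D⊆C f∈D) v∈W inc)
    dense : ∣ F ∣ ≤ ∣ W ∣ → ∣ cover G (C ─ F) ∣ + k ≤ ∣ C ─ F ∣
    dense ∣F∣≤∣W∣ = +-cancelʳ-≤ ∣ F ∣ _ _ (begin
      ∣ cover G (C ─ F) ∣ + k + ∣ F ∣  ≤⟨ +-monoʳ-≤ (∣ cover G (C ─ F) ∣ + k) ∣F∣≤∣W∣ ⟩
      ∣ cover G (C ─ F) ∣ + k + ∣ W ∣  ≡⟨ xy∙z≈xz∙y (∣ cover G (C ─ F) ∣) k (∣ W ∣) ⟩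
      ∣ cover G (C ─ F) ∣ + ∣ W ∣ + k  ≤⟨ +-monoˡ-≤ k (disjoint⇒∣p∣+∣q∣≤∣r∣ (cover-mono D⊆C) (vertices-in abs) disjoint) ⟩
      ∣ cover G C ∣ + k                ≡⟨ ∣C∣≡ ⟨
      ∣ C ∣                            ≡⟨ ∣p─q∣+∣q∣≡∣p∣ C F (edges-in abs) ⟨
      ∣ C ─ F ∣ + ∣ F ∣                ∎)

  expanding⇒circuit : ∀ {k} {C : EdgeSet} → Tight k G C → Expanding C → IsCircuitM k G C
  expanding⇒circuit {k} {C} tight@(_ , ∣C∣≡) expanding = tight , minimal
    where
    open ≡-Reasoning
    minimal : ∀ D → Tight k G D → D ⊆ C → D ≡ C
    minimal D (_ , ∣D∣≡) D⊆C = ⊆-antisym D⊆C C⊆D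
      where
      F : EdgeSet
      F = C ─ D
      W : VertexSet
      W = cover G C ─ cover G D
      absorbed : Absorbs C W F
      absorbed = record
        { edges-in    = p─q⊆p C D
        ; vertices-in = p─q⊆p (cover G C) (cover G D)
        ; absorbs     = λ e∈C v∈W inc → x∈p∧x∉q⇒x∈p─q e∈C λ e∈D →
            x∈p─q⇒x∉q (cover G C) (cover G D) v∈W (cover⁺ e∈D inc)
        }
      -- The tightness equations of `C` and `D` have the same excess `k`, so passing from `C` to `D`
      -- loses equally many vertices and edges.
      ∣W∣≡∣F∣ : ∣ W ∣ ≡ ∣ F ∣
      ∣W∣≡∣F∣ = +-cancelʳ-≡ ∣ D ∣ _ _ (begin
        ∣ W ∣ + ∣ D ∣                ≡⟨ cong (_+_ ∣ W ∣) ∣D∣≡ ⟩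
        ∣ W ∣ + (∣ cover G D ∣ + k)  ≡⟨ +-assoc (∣ W ∣) (∣ cover G D ∣) k ⟨
        ∣ W ∣ + ∣ cover G D ∣ + k    ≡⟨ cong (_+ k) (∣p─q∣+∣q∣≡∣p∣ (cover G C) (cover G D) (cover-mono D⊆C)) ⟩
        ∣ cover G C ∣ + k            ≡⟨ ∣C∣≡ ⟨
        ∣ C ∣                        ≡⟨ ∣p─q∣+∣q∣≡∣p∣ C D D⊆C ⟨
        ∣ F ∣ + ∣ D ∣                ∎)
      C⊆D : C ⊆ D
      C⊆D {e} e∈C with e ∈? D
      ... | yes e∈D = e∈D
      ... | no  e∉D = contradiction (expanding absorbed (e , x∈p∧x∉q⇒x∈p─q e∈C e∉D)) (<-irrefl ∣W∣≡∣F∣)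

  -- Two cycles

  -- After the deletion of an edge `e` of a first cycle there are still at least as many edges as
  -- vertices, so a second cycle exists that avoids `e`. A vertex of `K` guarantees that some edge
  -- remains.
  ∣V∣<∣E∣⇒twoCycles : (K : Subgraph G) → Nonempty (V K) → ∣ V K ∣ < ∣ E K ∣ → HasTwoCycles K
  ∣V∣<∣E∣⇒twoCycles K (v , v∈K) V<E
    with ∣cover∣≤⇒cycle ∣ E K ∣ (E K) refl (1≤∣p∣⇒Nonempty (E K) (≤-trans (s≤s z≤n) V<E))
           (≤-trans (p⊆q⇒∣p∣≤∣q∣ (cover⊆V K (λ e∈ → e∈))) (<⇒≤ V<E))
  ... | Z₁ , (_ , nil , ≢[] , _) , _ = contradiction refl ≢[]
  ... | Z₁ , cyc₁@(_ , cons e e∈Z₁ _ _ , _) , VZ₁⊆ , EZ₁⊆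
    with ∣cover∣≤⇒cycle ∣ E K - e ∣ (E K - e) refl (1≤∣p∣⇒Nonempty (E K - e) (≤-trans (x∈p⇒1≤∣p∣ v∈K) V≤))
           (≤-trans (p⊆q⇒∣p∣≤∣q∣ (cover⊆V K (p─q⊆p (E K) ⁅ e ⁆))) V≤)
    where
    V≤ : ∣ V K ∣ ≤ ∣ E K - e ∣
    V≤ = s≤s⁻¹ (≤-trans V<E (≤-reflexive (sym (1+∣p-x∣≡∣p∣ (E K) (EZ₁⊆ e∈Z₁)))))
  ...   | Z₂ , cyc₂ , VZ₂⊆ , EZ₂⊆ =
    Z₁ , Z₂ ,
    (cover⊆V K (λ e∈ → e∈) ∘ VZ₁⊆ , EZ₁⊆) , cyc₁ ,
    (cover⊆V K (p─q⊆p (E K) ⁅ e ⁆) ∘ VZ₂⊆ , p─q⊆p (E K) ⁅ e ⁆ ∘ EZ₂⊆) , cyc₂ ,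
    λ { (_ , E≡) → x∉p-x (E K) e (EZ₂⊆ (subst (e ∈_) E≡ e∈Z₁)) }

  cycle⇒¬twoCycles : (K : Subgraph G) → IsCycle K → ¬ HasTwoCycles K
  cycle⇒¬twoCycles K cyc (Z₁ , Z₂ , Z₁⊑K , cyc₁ , Z₂⊑K , cyc₂ , Z₁≢Z₂) =
    let V₁ , E₁ = subcycle-of-cycle K Z₁ cyc cyc₁ Z₁⊑K
        V₂ , E₂ = subcycle-of-cycle K Z₂ cyc cyc₂ Z₂⊑K
    in Z₁≢Z₂ (trans V₁ (sym V₂) , trans E₁ (sym E₂))

mainTheorem8 : (G : Graph) (C : Graph.EdgeSet G) (k : ℕ) → 1 ≤ k →
    (IsCircuitM k G C ⇔ (Δ (G ⟨ C ⟩) ≡ + k × IsCactiGraph (G ⟨ C ⟩))) ×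
    (IsCactiGraph (G ⟨ C ⟩) ⇔
    (NoLeaves (G ⟨ C ⟩) × (∀ K → IsComponent (G ⟨ C ⟩) K → HasTwoCycles K)))
mainTheorem8 G C k 1≤k =
  mk⇔ (λ circuit → tight⇒Δ (proj₁ circuit) , expanding⇒cacti (circuit⇒expanding 1≤k circuit))
      (λ (Δ≡k , cacti) → expanding⇒circuit (Δ⇒tight Δ≡k) (cacti⇒expanding cacti)) ,
  -- A component is an absorbing pair, so expansion gives it more edges than vertices and hence two
  -- cycles.
  mk⇔ (λ cacti → proj₁ (proj₂ cacti) , λ K comp → ∣V∣<∣E∣⇒twoCycles K (proj₁ (proj₁ (proj₂ comp)))
        (cacti⇒expanding cacti (component-absorbed C K comp) (component-has-edge C K comp)))
      (λ (¬leaf , two) → (λ v (v∈ , none) → none (cover⁻ v∈)) , ¬leaf ,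
        λ K comp cyc → cycle⇒¬twoCycles K cyc (two K comp))
  where
  H = G ⟨ C ⟩
  tight⇒Δ : Tight k G C → Δ H ≡ + k
  tight⇒Δ (_ , ∣C∣≡) = m≡n+k⇒m-n≡k ∣ V H ∣ ∣C∣≡
  Δ⇒tight : Δ H ≡ + k → Tight k G C
  -- Nonemptiness of `C` comes from `k` being positive.
  Δ⇒tight Δ≡k = 1≤∣p∣⇒Nonempty C (≤-trans 1≤k (≤-trans (m≤n+m k _) (≤-reflexive (sym ∣C∣≡)))) , ∣C∣≡
    where
    ∣C∣≡ : ∣ C ∣ ≡ ∣ V H ∣ + k
    ∣C∣≡ = m-n≡k⇒m≡n+k ∣ V H ∣ Δ≡k
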